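{- Let $\varepsilon \in (0,1]$, and let $s \leq t$ be positive integers such that $\varepsilon \cdot t \geq s^2 - (3+\varepsilon)s$. If $n \geq (2+\varepsilon)(s+t)$ and $N \geq (n-1) + s$, then $K_N \rightarrow (P_n,K_{s,t})$.
   Context: For graphs $K,G,H$, the notation $K\rightarrow(G,H)$ means that every coloring of the edges of $K$ with red and blue contains a red copy of $G$ or a blue copy of $H$. $K_N$ is the complete graph on $N$ vertices, $P_n$ is the path with $n$ vertices, and $K_{s,t}$ is the complete bipartite graph with parts of sizes $s$ and $t$. -}

module Defs where

open import Data.Nat using (ℕ; suc)
open import Data.Fin using (Fin; toℕ)
open import Data.Bool using (Bool; true; false)
open import Data.Product using (Σ; _×_)
open import Data.Sum using (_⊎_)
open import Relation.Binary.PropositionalEquality using (_≡_; _≢_)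
open import Function.Definitions using (Injective)
open import Data.Integer using (+_)
open import Data.Rational using (ℚ; _/_)

data Colour : Set where
  red blue : Colour

-- A red/blue colouring of the edges of K_N: a colour for each ordered pair,
-- required to be symmetric (only values on distinct pairs matter).
record Colouring (N : ℕ) : Set where
  field
    col  : Fin N → Fin N → Colour
    symm : ∀ u v → col u v ≡ col v u
open Colouring public

record PathCopy {N : ℕ} (c : Colouring N) (k : Colour) (n : ℕ) : Set where
  field
    vtx  : Fin n → Fin N
    inj  : Injective _≡_ _≡_ vtx
    edge : ∀ (i j : Fin n) → toℕ j ≡ suc (toℕ i) → col c (vtx i) (vtx j) ≡ k

record BipCopy {N : ℕ} (c : Colouring N) (k : Colour) (s t : ℕ) : Set where
  field
    left     : Fin s → Fin N
    right    : Fin t → Fin N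
    left-inj  : Injective _≡_ _≡_ left
    right-inj : Injective _≡_ _≡_ right
    disjoint  : ∀ i j → left i ≢ right j
    edge      : ∀ i j → col c (left i) (right j) ≡ k

Arrows : ℕ → ℕ → ℕ → ℕ → Set
Arrows N n s t = (c : Colouring N) → PathCopy c red n ⊎ BipCopy c blue s t

ℕ→ℚ : ℕ → ℚ
ℕ→ℚ m = (+ m) / 1

{-# OPTIONS --safe #-}

-- The hypotheses on ε add up to s² + 2t ≤ n + s.  Let P be a longest red path;
-- if it has fewer than n vertices, then at least s vertices lie outside it.
-- Depth-first search outside P yields a set A of s vertices whose red neighbours
-- lie in A, on P, or on the search stack Q.  Suppose consecutive vertices x, y of P
-- have red neighbours v, u ∈ A.  Then v ≠ u, since otherwise v could be inserted
-- between x and y, and the ordered pair (v , u) does not occur again later on P,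
-- since otherwise P could be rerouted through both v and u.  So at most s(s − 1)
-- consecutive pairs of vertices of P are both adjacent to A.  Each a ∈ A starts a
-- red path outside P with more than |Q|/2 vertices, so no vertex within that
-- distance of an end of P is adjacent to a.  Hence A has at most
-- (|P| − |Q| + s(s − 1))/2 neighbours on P, which leaves at least t vertices
-- outside A joined to A in blue only.
module Submission where

open import Defs
open import Data.Nat using (ℕ; _≤_; _∸_; _*_; _+_)
open import Data.Rational using (ℚ; 0ℚ; 1ℚ; _<_) renaming (_≤_ to _≤ℚ_; _*_ to _*ℚ_; _+_ to _+ℚ_; _-_ to _-ℚ_)

open import Level using (0ℓ)
open import Data.Bool using (if_then_else_)
open import Data.Fin using (Fin; zero; suc; toℕ; inject≤)
import Data.Fin.Properties as Fin
open import Data.Integer using () renaming (+_ to pos)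
import Data.Integer as ℤ
import Data.Integer.Properties as ℤ
open import Data.List using (List; []; _∷_; _++_; _ʳ++_; length; reverse; map; filter; last; lookup; cartesianProduct; allFin)
open import Data.List.Properties using (length-++; length-ʳ++; length-map; length-tabulate; ʳ++-defn; reverse-involutive; ++-assoc; filter-accept)
open import Data.List.Membership.Propositional using (_∈_; _∉_)
import Data.List.Membership.DecPropositional as DecMembership
open import Data.List.Membership.Propositional.Properties using (∈-∃++; ∈-++⁺ˡ; ∈-++⁺ʳ; ∈-++⁻; ∈-map⁻; ∈-filter⁺; ∈-filter⁻; ∈-allFin; ∈-lookup; ∈-cartesianProduct⁺)
open import Data.List.Relation.Binary.Permutation.Propositional using (_↭_; ↭-sym; ↭-trans; ↭⇒↭ₛ; prep; module PermutationReasoning)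
open import Data.List.Relation.Binary.Permutation.Propositional.Properties using (++↭ʳ++; shift; ++⁺ʳ; ++-comm; ↭-length; All-resp-↭; ∈-resp-↭)
import Data.List.Relation.Binary.Permutation.Setoid.Properties as ↭ₛ
open import Data.List.Relation.Unary.All as All using (All; []; _∷_)
import Data.List.Relation.Unary.All.Properties as All
open import Data.List.Relation.Unary.AllPairs using ([]; _∷_)
open import Data.List.Relation.Unary.Any as Any using (Any; here; there)
open import Data.List.Relation.Unary.Linked as Linked using (Linked; []; [-]; _∷_; linked?)
open import Data.List.Relation.Unary.Unique.Propositional using (Unique)
import Data.List.Relation.Unary.Unique.Propositional.Properties as Unique
import Data.List.Relation.Unary.Unique.DecPropositional as DecUnique
open import Data.Maybe.Relation.Unary.All as Maybe using (just; nothing)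
open import Data.Nat using (zero; suc; z≤n; s≤s; ⌊_/2⌋; ⌈_/2⌉; _≤?_) renaming (_<_ to _<ℕ_)
import Data.Nat.Properties as ℕ
open import Data.Nat.Tactic.RingSolver using (solve-∀)
open import Data.Product using (∃; ∃₂; _×_; _,_; proj₁; proj₂)
open import Data.Rational using (toℚᵘ)
import Data.Rational.Properties as ℚ
open import Data.Rational.Solver using (module +-*-Solver)
import Data.Rational.Unnormalised as ℚᵘ
import Data.Rational.Unnormalised.Properties as ℚᵘ
open import Data.Sum using (_⊎_; inj₁; inj₂; [_,_]′)
open import Data.Unit using (⊤; tt)
open import Function using (_∘_; id)
open import Relation.Binary using (Rel; Symmetric) renaming (Decidable to Decidable₂)
open import Relation.Binary.PropositionalEquality using (_≡_; _≢_; refl; sym; trans; cong; cong₂; subst; subst₂; setoid)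
open import Relation.Nullary using (¬_; Dec; yes; no; does; contradiction)
open import Relation.Nullary.Decidable using (_×-dec_; ¬?; map′)
open import Relation.Unary using (Pred; Decidable)

private
  variable
    A B : Set

-- Counting with duplicate-free lists.

Unique-resp-↭ : ∀ {xs ys : List A} → xs ↭ ys → Unique xs → Unique ys
Unique-resp-↭ p = ↭ₛ.Unique-resp-↭ (setoid _) (↭⇒↭ₛ p)

-- Each head of `xs` is deleted from `ys` at the position that membership supplies.
length-≤ : ∀ {xs ys : List A} → Unique xs → (∀ {x} → x ∈ xs → x ∈ ys) → length xs ≤ length ys
length-≤ [] _ = z≤n
length-≤ {xs = x ∷ xs} (x≢ ∷ uniq) xs⊆ys with ∈-∃++ (xs⊆ys (here refl))
... | l , r , refl =
  subst (suc (length xs) ≤_) (sym (↭-length (shift x l r))) (s≤s (length-≤ uniq xs⊆l++r))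
  where
  xs⊆l++r : ∀ {y} → y ∈ xs → y ∈ l ++ r
  xs⊆l++r y∈xs with ∈-resp-↭ (shift x l r) (xs⊆ys (there y∈xs))
  ... | here refl = contradiction refl (All.lookup x≢ y∈xs)
  ... | there y∈  = y∈

length-cartesianProduct : ∀ (xs : List A) (ys : List B) →
  length (cartesianProduct xs ys) ≡ length xs * length ys
length-cartesianProduct []       ys = refl
length-cartesianProduct (x ∷ xs) ys =
  trans (length-++ (map (x ,_) ys)) (cong₂ _+_ (length-map (x ,_) ys) (length-cartesianProduct xs ys))

private
  diag : A → A × A
  diag x = x , x

-- The diagonal of `xs` is disjoint from `ps`, and both fit into the square of `xs`. This is the
-- source of s(s - 1), kept in additive form to avoid truncated subtraction.
offDiagonal-bound : ∀ (xs : List A) {ps : List (A × A)} → Unique xs → Unique ps →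
  (∀ {x y} → (x , y) ∈ ps → x ∈ xs × y ∈ xs × x ≢ y) →
  length ps + length xs ≤ length xs * length xs
offDiagonal-bound xs {ps} uniqˣ uniqᵖ off =
  subst₂ _≤_ (trans (length-++ ps) (cong (length ps +_) (length-map diag xs))) (length-cartesianProduct xs xs)
    (length-≤ (Unique.++⁺ uniqᵖ (Unique.map⁺ (cong proj₁) uniqˣ) disj) incl)
  where
  disj : ∀ {p} → ¬ (p ∈ ps × p ∈ map diag xs)
  disj (p∈ps , p∈diag) with ∈-map⁻ diag p∈diag
  ... | _ , _ , refl = proj₂ (proj₂ (off p∈ps)) refl
  incl : ∀ {p} → p ∈ ps ++ map diag xs → p ∈ cartesianProduct xs xs
  incl p∈ with ∈-++⁻ ps p∈
  ... | inj₁ p∈ps = let x∈ , y∈ , _ = off p∈ps in ∈-cartesianProduct⁺ x∈ y∈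
  ... | inj₂ p∈diag with ∈-map⁻ diag p∈diag
  ...   | _ , x∈ , refl = ∈-cartesianProduct⁺ x∈ x∈

-- Lists cut at an element, with the left part reversed.

∈⇒ʳ++ : ∀ {x : A} {xs} → x ∈ xs → ∃₂ λ l r → xs ≡ l ʳ++ x ∷ r
∈⇒ʳ++ {x = x} x∈xs with ∈-∃++ x∈xs
... | l , r , refl = reverse l , r ,
  sym (trans (ʳ++-defn (reverse l)) (cong (_++ x ∷ r) (reverse-involutive l)))

ʳ++-↭ : ∀ l (x : A) r → l ʳ++ x ∷ r ↭ x ∷ l ++ r
ʳ++-↭ l x r = ↭-trans (↭-sym (++↭ʳ++ l (x ∷ r))) (shift x l r)

Unique-++⁻ : ∀ xs {ys : List A} → Unique (xs ++ ys) → Unique xs × Unique ys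
Unique-++⁻ []       uniq        = [] , uniq
Unique-++⁻ (x ∷ xs) (x≢ ∷ uniq) with Unique-++⁻ xs uniq
... | uniqˣ , uniqʸ = All.++⁻ˡ xs x≢ ∷ uniqˣ , uniqʸ

module _ {A : Set} {R : Rel A 0ℓ} (R-sym : ∀ {x y} → R x y → R y x) where

  -- The left arm is traversed backwards in the joined list, which is where symmetry of `R` enters.
  Linked-ʳ++⁺ : ∀ l {x r} → Linked R (x ∷ l) → Linked R (x ∷ r) → Linked R (l ʳ++ x ∷ r)
  Linked-ʳ++⁺ []      _           xr = xr
  Linked-ʳ++⁺ (y ∷ l) (xy ∷ yl) xr = Linked-ʳ++⁺ l yl (R-sym xy ∷ xr)

  Linked-ʳ++⁻ : ∀ l {x r} → Linked R (l ʳ++ x ∷ r) → Linked R (x ∷ l) × Linked R (x ∷ r)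
  Linked-ʳ++⁻ []      xr = [-] , xr
  Linked-ʳ++⁻ (y ∷ l) lr with Linked-ʳ++⁻ l lr
  ... | yl , yx ∷ xr = R-sym yx ∷ yl , xr

Linked-++⁻ʳ : ∀ {R : Rel A 0ℓ} xs {ys} → Linked R (xs ++ ys) → Linked R ys
Linked-++⁻ʳ []       lk = lk
Linked-++⁻ʳ (x ∷ xs) lk = Linked-++⁻ʳ xs (Linked.tail lk)

lookup-injective : ∀ {xs : List A} → Unique xs → ∀ {i j} → lookup xs i ≡ lookup xs j → i ≡ j
lookup-injective (x≢ ∷ uq) {zero}  {zero}  eq = refl
lookup-injective (x≢ ∷ uq) {zero}  {suc j} eq = contradiction eq (All.lookup x≢ (∈-lookup j))
lookup-injective (x≢ ∷ uq) {suc i} {zero}  eq = contradiction (sym eq) (All.lookup x≢ (∈-lookup i))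
lookup-injective (x≢ ∷ uq) {suc i} {suc j} eq = cong suc (lookup-injective uq eq)

lookup-linked : ∀ {R : Rel A 0ℓ} {xs} → Linked R xs → ∀ i j → toℕ j ≡ suc (toℕ i) → R (lookup xs i) (lookup xs j)
lookup-linked (r ∷ _)  zero    (suc zero)    _  = r
lookup-linked (_ ∷ lk) (suc i) (suc j)       eq = lookup-linked lk i j (ℕ.suc-injective eq)

-- Exhaustive search over lists of vertices.

module _ {N : ℕ} where

  private V = Fin N

  open DecMembership (Fin._≟_ {N}) using (_∈?_)

  length≤N : ∀ {xs : List V} → Unique xs → length xs ≤ N
  length≤N {xs} uniq = subst (length xs ≤_) (length-tabulate (λ i → i)) (length-≤ uniq (λ _ → ∈-allFin _))

  cover⇒N≤length : ∀ {xs : List V} → (∀ v → v ∈ xs) → N ≤ length xs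
  cover⇒N≤length {xs} cover = subst (_≤ length xs) (length-tabulate (λ i → i)) (length-≤ (Unique.allFin⁺ N) (λ _ → cover _))

  missing : ∀ (xs : List V) → length xs <ℕ N → ∃ λ v → v ∉ xs
  missing xs short with Fin.all? (_∈? xs)
  ... | yes cover = contradiction (cover⇒N≤length cover) (ℕ.<⇒≱ short)
  ... | no ¬cover = let v , v∉ , _ = Fin.¬∀⟶∃¬-smallest N (_∈ xs) (_∈? xs) ¬cover in v , v∉

  -- Fixing the length makes the search finite: the head ranges over `Fin N`, and the rest is
  -- searched under the predicate specialised to that head.
  ∃-ofLength? : ∀ n {Q : Pred (List V) 0ℓ} → Decidable Q → Dec (∃ λ xs → length xs ≡ n × Q xs)
  ∃-ofLength? zero    Q? = map′ (λ q → [] , refl , q) (λ { ([] , _ , q) → q }) (Q? [])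
  ∃-ofLength? (suc n) Q? = map′
    (λ { (x , xs , refl , q) → x ∷ xs , refl , q })
    (λ { (x ∷ xs , refl , q) → x , xs , refl , q })
    (Fin.any? (λ x → ∃-ofLength? n (λ xs → Q? (x ∷ xs))))

  -- Lengths are tried from `b` downwards; when no list attains the bound, the bound drops by one.
  longest : ∀ {Q : Pred (List V) 0ℓ} → Decidable Q → Q [] → ∀ b → (∀ xs → Q xs → length xs ≤ b) →
    ∃ λ xs → Q xs × (∀ ys → Q ys → length ys ≤ length xs)
  longest Q? Q[] zero    bound = [] , Q[] , bound
  longest Q? Q[] (suc b) bound with ∃-ofLength? (suc b) Q?
  ... | yes (xs , |xs|≡ , q) = xs , q , λ ys q′ → subst (length ys ≤_) (sym |xs|≡) (bound ys q′)
  ... | no ∄ = longest Q? Q[] b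
    (λ xs q → ℕ.≤-pred (ℕ.≤∧≢⇒< (bound xs q) (λ eq → ∄ (xs , eq , q))))

-- Counting marked elements along a list.

module _ {A B : Set} {Hit : Pred A 0ℓ} (Hit? : Decidable Hit) (label : ∀ {x} → Hit x → B) where

  private
    link : ∀ {x y} → Dec (Hit x) → Dec (Hit y) → List (B × B) → List (B × B)
    link (yes p) (yes q) ps = (label p , label q) ∷ ps
    link (yes _) (no _)  ps = ps
    link (no _)  _       ps = ps

  -- Labels are kept rather than a mere count, so that the number of entries can later be bounded by
  -- showing them distinct.
  consecutive : List A → List (B × B)
  consecutive []          = []
  consecutive (x ∷ [])    = []
  consecutive (x ∷ y ∷ r) = link (Hit? x) (Hit? y) (consecutive (y ∷ r))

  private
    hits pairs headHit : List A → ℕ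
    hits r = length (filter Hit? r)
    pairs r = length (consecutive r)
    headHit []      = 0
    headHit (x ∷ _) = if does (Hit? x) then 1 else 0

    hits-accept : ∀ {x} r → Hit x → hits (x ∷ r) ≡ suc (hits r)
    hits-accept r px = cong length (filter-accept Hit? {xs = r} px)

    pairs-accept : ∀ {x} r → Hit x → pairs (x ∷ r) ≡ headHit r + pairs r
    pairs-accept []      px = refl
    pairs-accept {x} (y ∷ r) px with Hit? x | Hit? y
    ... | yes _  | yes _ = refl
    ... | yes _  | no  _ = refl
    ... | no ¬px | _     = contradiction px ¬px

    pairs-reject : ∀ {x} r → ¬ Hit x → pairs (x ∷ r) ≡ pairs r
    pairs-reject []      ¬px = refl
    pairs-reject {x} (y ∷ r) ¬px with Hit? x | Hit? y
    ... | yes px | _ = contradiction px ¬px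
    ... | no  _  | _ = refl

    headHit-accept : ∀ {x} r → Hit x → headHit (x ∷ r) ≡ 1
    headHit-accept {x} r px with Hit? x
    ... | yes _  = refl
    ... | no ¬px = contradiction px ¬px

  module _ (P : List A) (h : ℕ)
    (inner : ∀ l x r → P ≡ l ʳ++ x ∷ r → Hit x → h ≤ length l × h ≤ length r) where

    -- Successive hits are separated by a non-hit unless they contribute to `pairs`, and at least
    -- `h` elements follow the last hit. So m hits occupy at least 2m - 1 - `pairs` positions before
    -- these `h`; the missing one is supplied by a non-hit at the head of `r`, or else by `headHit`.
    suffix-hits : ∀ l r → P ≡ l ʳ++ r →
      hits r ≡ 0 ⊎ 2 * hits r + h ≤ length r + pairs r + headHit r
    suffix-hits l []      _  = inj₁ refl
    suffix-hits l (x ∷ r) eq with Hit? x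
    ... | no ¬px with suffix-hits (x ∷ l) r eq
    ...   | inj₁ none = inj₁ none
    ...   | inj₂ some = inj₂ (begin
      2 * hits r + h                          ≤⟨ some ⟩
      length r + pairs r + headHit r          ≤⟨ ℕ.+-monoʳ-≤ (length r + pairs r) (headHit≤1 r) ⟩
      length r + pairs r + 1                  ≡⟨ reassoc (length r) (pairs r) ⟩
      suc (length r) + pairs r + 0            ≡⟨ cong (λ p → suc (length r) + p + 0) (pairs-reject r ¬px) ⟨
      suc (length r) + pairs (x ∷ r) + 0      ∎)
      where
      open ℕ.≤-Reasoning
      headHit≤1 : ∀ r → headHit r ≤ 1
      headHit≤1 []      = z≤n
      headHit≤1 (x ∷ _) with Hit? x
      ... | yes _ = ℕ.≤-refl
      ... | no  _ = z≤n
      reassoc : ∀ a b → a + b + 1 ≡ suc a + b + 0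
      reassoc = solve-∀
    suffix-hits l (x ∷ r) eq | yes px with suffix-hits (x ∷ l) r eq
    -- No hit remains in `r`, so `x` is the last one and `inner` supplies the `h` elements behind
    -- it.
    ...   | inj₁ none = inj₂ (begin
      2 * suc (hits r) + h                    ≡⟨ cong (λ c → 2 * suc c + h) none ⟩
      2 + h                                   ≤⟨ ℕ.+-monoʳ-≤ 2 (proj₂ (inner l x r eq px)) ⟩
      2 + length r                            ≤⟨ ℕ.m≤m+n (2 + length r) (pairs (x ∷ r)) ⟩
      2 + length r + pairs (x ∷ r)            ≡⟨ reassoc (length r) (pairs (x ∷ r)) ⟩
      suc (length r) + pairs (x ∷ r) + 1      ∎)
      where
      open ℕ.≤-Reasoning
      reassoc : ∀ a b → 2 + a + b ≡ suc a + b + 1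
      reassoc = solve-∀
    ...   | inj₂ some = inj₂ (begin
      2 * suc (hits r) + h                         ≡⟨ reassoc₁ (hits r) h ⟩
      2 + (2 * hits r + h)                         ≤⟨ ℕ.+-monoʳ-≤ 2 some ⟩
      2 + (length r + pairs r + headHit r)         ≡⟨ reassoc₂ (length r) (pairs r) (headHit r) ⟩
      suc (length r) + (headHit r + pairs r) + 1   ≡⟨ cong (λ p → suc (length r) + p + 1) (pairs-accept r px) ⟨
      suc (length r) + pairs (x ∷ r) + 1           ∎)
      where
      open ℕ.≤-Reasoning
      reassoc₁ : ∀ a b → 2 * suc a + b ≡ 2 + (2 * a + b)
      reassoc₁ = solve-∀
      reassoc₂ : ∀ a b c → 2 + (a + b + c) ≡ suc a + (c + b) + 1
      reassoc₂ = solve-∀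

    -- Non-hits are passed over up to the first hit. There `inner` gives `h` elements on the left,
    -- `suffix-hits` accounts for the rest, and `headHit` becomes the final `1`.
    zipper-hits : ∀ l r → P ≡ l ʳ++ r →
      hits r ≡ 0 ⊎ 2 * hits r + 2 * h ≤ length l + length r + pairs r + 1
    zipper-hits l []      _  = inj₁ refl
    zipper-hits l (x ∷ r) eq with Hit? x
    ... | no ¬px with zipper-hits (x ∷ l) r eq
    ...   | inj₁ none = inj₁ none
    ...   | inj₂ some = inj₂ (begin
      2 * hits r + 2 * h                               ≤⟨ some ⟩
      suc (length l) + length r + pairs r + 1          ≡⟨ cong (λ p → suc (length l) + length r + p + 1) (pairs-reject r ¬px) ⟨
      suc (length l) + length r + pairs (x ∷ r) + 1    ≡⟨ cong (λ m → m + pairs (x ∷ r) + 1) (ℕ.+-suc (length l) (length r)) ⟨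
      length l + suc (length r) + pairs (x ∷ r) + 1    ∎)
      where open ℕ.≤-Reasoning
    zipper-hits l (x ∷ r) eq | yes px with suffix-hits l (x ∷ r) eq
    ...   | inj₁ none with () ← trans (sym (hits-accept r px)) none
    ...   | inj₂ some = inj₂ (begin
      2 * suc (hits r) + 2 * h                                       ≡⟨ cong (λ c → 2 * c + 2 * h) (hits-accept r px) ⟨
      2 * hits (x ∷ r) + 2 * h                                       ≡⟨ reassoc₁ (hits (x ∷ r)) h ⟩
      h + (2 * hits (x ∷ r) + h)                                     ≤⟨ ℕ.+-mono-≤ (proj₁ (inner l x r eq px)) some ⟩
      length l + (suc (length r) + pairs (x ∷ r) + headHit (x ∷ r))  ≡⟨ cong (λ d → length l + (suc (length r) + pairs (x ∷ r) + d)) (headHit-accept r px) ⟩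
      length l + (suc (length r) + pairs (x ∷ r) + 1)                ≡⟨ reassoc₂ (length l) (suc (length r)) (pairs (x ∷ r)) ⟩
      length l + suc (length r) + pairs (x ∷ r) + 1                  ∎)
      where
      open ℕ.≤-Reasoning
      reassoc₁ : ∀ a b → 2 * a + 2 * b ≡ b + (2 * a + b)
      reassoc₁ = solve-∀
      reassoc₂ : ∀ a b c → a + (b + c + 1) ≡ a + b + c + 1
      reassoc₂ = solve-∀

    hits-bound : hits P ≡ 0 ⊎ 2 * hits P + 2 * h ≤ length P + pairs P + 1
    hits-bound = zipper-hits [] P refl

-- Paths in a finite graph.

module Paths {N : ℕ} {E : Rel (Fin N) 0ℓ} (E? : Decidable₂ E) (E-sym : Symmetric E) where

  private V = Fin N

  open DecMembership (Fin._≟_ {N}) using (_∈?_)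
  open DecUnique (Fin._≟_ {N}) using (unique?)

  record Path (R : Pred V 0ℓ) (xs : List V) : Set where
    constructor path
    field
      linked : Linked E xs
      unique : Unique xs
      within : All R xs
  open Path

  path? : ∀ {R} → Decidable R → Decidable (Path R)
  path? R? xs with linked? E? xs ×-dec unique? xs ×-dec All.all? R? xs
  ... | yes (lk , uq , wi) = yes (path lk uq wi)
  ... | no ¬p              = no λ (path lk uq wi) → ¬p (lk , uq , wi)

  Longest : Pred V 0ℓ → Pred (List V) 0ℓ
  Longest R xs = ∀ ys → Path R ys → length ys ≤ length xs

  longestPath : ∀ {R} → Decidable R → ∃ λ xs → Path R xs × Longest R xs
  longestPath R? = longest (path? R?) (path [] [] []) N (λ _ p → length≤N (unique p))

  path-map : ∀ {R S : Pred V 0ℓ} {xs} → (∀ {x} → R x → S x) → Path R xs → Path S xs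
  path-map f (path lk uq wi) = path lk uq (All.map f wi)

  path-∷ : ∀ {R x y xs} → E x y → x ∉ y ∷ xs → R x → Path R (y ∷ xs) → Path R (x ∷ y ∷ xs)
  path-∷ {x = x} e x∉ rx (path lk uq wi) = path (e ∷ lk) (All.¬Any⇒All¬ _ x∉ ∷ uq) (rx ∷ wi)

  -- l ʳ++ x ∷ r is a path cut at x: both arms l and r are read outwards from x.
  arms : ∀ {R} l {x r} → Path R (l ʳ++ x ∷ r) → Path R (x ∷ l) × Path R (x ∷ r)
  arms l {x} {r} (path lk uq wi) with Linked-ʳ++⁻ E-sym l lk
  ... | lkˡ , lkʳ = path lkˡ (proj₁ uniq) (proj₁ all) , path lkʳ uniqʳ (All.head (proj₁ all) ∷ proj₂ all)
    where
    uniq = Unique-++⁻ (x ∷ l) (Unique-resp-↭ (ʳ++-↭ l x r) uq)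
    uniqʳ = proj₂ (Unique-++⁻ l (Unique-resp-↭ (↭-sym (++↭ʳ++ l (x ∷ r))) uq))
    all = All.++⁻ (x ∷ l) (All-resp-↭ (ʳ++-↭ l x r) wi)

  joinArms : ∀ {R l x r} → Path R (x ∷ l) → Path R (x ∷ r) → (∀ {v} → v ∈ l → v ∉ x ∷ r) → Path R (l ʳ++ x ∷ r)
  joinArms {l = l} {x} {r} (path lkˡ (_ ∷ uqˡ) (_ ∷ wiˡ)) (path lkʳ uqʳ wiʳ) disj =
    path (Linked-ʳ++⁺ E-sym l lkˡ lkʳ)
         (Unique-resp-↭ (++↭ʳ++ l (x ∷ r)) (Unique.++⁺ uqˡ uqʳ λ (p , q) → disj p q))
         (All-resp-↭ (++↭ʳ++ l (x ∷ r)) (All.++⁺ wiˡ wiʳ))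

  -- Rerouting a longest path.

  module Extremal {P : List V} (P-path : Path (λ _ → ⊤) P) (P-longest : Longest (λ _ → ⊤) P) where

    -- Both reroutings below exhibit a permutation of `P` with extra vertices; length and absence of
    -- repetition then carry over, leaving only adjacency to verify. Singling out `v` makes the new
    -- path strictly longer.
    ¬longer : ∀ {xs} v ys → xs ↭ v ∷ ys ++ P → Unique (v ∷ ys ++ P) → ¬ Linked E xs
    ¬longer {xs} v ys xs↭ uniq lk = ℕ.<⇒≱ P<xs (P-longest xs (path lk (Unique-resp-↭ (↭-sym xs↭) uniq) (All.universal (λ _ → tt) xs)))
      where
      P<xs : length P <ℕ length xs
      P<xs = subst (length P <ℕ_) (sym (trans (↭-length xs↭) (cong suc (length-++ ys)))) (s≤s (ℕ.m≤n+m (length P) (length ys)))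

    fresh : ∀ {v} → v ∉ P → Unique (v ∷ P)
    fresh v∉ = All.¬Any⇒All¬ P v∉ ∷ unique P-path

    ¬insert : ∀ {l x y r v} → P ≡ l ʳ++ x ∷ y ∷ r → v ∉ P → E v x → ¬ E v y
    ¬insert {l} {x} {y} {r} {v} refl v∉ vx vy with Linked-ʳ++⁻ E-sym l (linked P-path)
    ... | xl , xy ∷ yr =
      ¬longer v [] perm (fresh v∉) (Linked-ʳ++⁺ E-sym l xl (E-sym vx ∷ vy ∷ yr))
      where
      open PermutationReasoning
      perm : l ʳ++ x ∷ v ∷ y ∷ r ↭ v ∷ (l ʳ++ x ∷ y ∷ r)
      perm = begin
        l ʳ++ x ∷ v ∷ y ∷ r       ↭⟨ ʳ++-↭ (x ∷ l) v (y ∷ r) ⟩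
        v ∷ x ∷ l ++ y ∷ r        ↭⟨ prep v (++↭ʳ++ (x ∷ l) (y ∷ r)) ⟩
        v ∷ (l ʳ++ x ∷ y ∷ r)     ∎

    data Straddle (v u : V) : List V → Set where
      here  : ∀ {x y r} → E v x → E u y → Straddle v u (x ∷ y ∷ r)
      there : ∀ {x r} → Straddle v u r → Straddle v u (x ∷ r)

    -- The cut is made just before `z`. The last vertex of `y ∷ g` is the neighbour of `v` in the
    -- straddled pair but stays anonymous: `glue` records that adjacency by letting any linked list
    -- from `v` follow the segment.
    straddle-split : ∀ {v u y s} → Linked E (y ∷ s) → Straddle v u (y ∷ s) →
      ∃ λ g → ∃₂ λ z r → y ∷ s ≡ (y ∷ g) ++ z ∷ r × E u z ×
        (∀ {τ} → Linked E (v ∷ τ) → Linked E ((y ∷ g) ++ v ∷ τ))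
    straddle-split {y = y} {z ∷ r} _ (here vy uz) = [] , z , r , refl , uz , λ lk → E-sym vy ∷ lk
    straddle-split {y = y} {s = w ∷ s} (yw ∷ ws) (there st) with straddle-split ws st
    ... | g , z , r , refl , uz , glue = w ∷ g , z , r , refl , uz , λ lk → yw ∷ glue lk

    -- p₁ … x v x′ … y u y′ … is longer than p₁ … x y … x′ y′ …
    ¬cross : ∀ {l x y s v u} → P ≡ l ʳ++ x ∷ y ∷ s → v ∉ P → u ∉ P → v ≢ u →
      E v x → E u y → ¬ Straddle v u (y ∷ s)
    ¬cross {l} {x} {y} {s} {v} {u} P≡ v∉ u∉ v≢u vx uy st
      with Linked-ʳ++⁻ E-sym l (subst (Linked E) P≡ (linked P-path))
    ... | xl , xy ∷ ys with straddle-split ys st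
    ...   | g , z , r , s≡ , uz , glue =
      ¬longer u (v ∷ []) perm ((u≢v ∷ All.¬Any⇒All¬ P u∉) ∷ fresh v∉)
        (Linked-ʳ++⁺ E-sym (y ∷ g ++ v ∷ x ∷ l) (uy ∷ glue (vx ∷ xl))
          (uz ∷ Linked-++⁻ʳ (y ∷ g) (subst (Linked E) s≡ ys)))
      where
      u≢v : u ≢ v
      u≢v = v≢u ∘ sym
      open PermutationReasoning
      perm : (y ∷ g ++ v ∷ x ∷ l) ʳ++ (u ∷ z ∷ r) ↭ u ∷ v ∷ P
      perm = begin
        (y ∷ g ++ v ∷ x ∷ l) ʳ++ (u ∷ z ∷ r)         ↭⟨ ʳ++-↭ (y ∷ g ++ v ∷ x ∷ l) u (z ∷ r) ⟩
        u ∷ ((y ∷ g) ++ v ∷ x ∷ l) ++ z ∷ r          ↭⟨ prep u (++⁺ʳ (z ∷ r) (shift v (y ∷ g) (x ∷ l))) ⟩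
        u ∷ v ∷ ((y ∷ g) ++ x ∷ l) ++ z ∷ r          ↭⟨ prep u (prep v (++⁺ʳ (z ∷ r) (++-comm (y ∷ g) (x ∷ l)))) ⟩
        u ∷ v ∷ ((x ∷ l) ++ y ∷ g) ++ z ∷ r          ≡⟨ cong (λ q → u ∷ v ∷ q) (++-assoc (x ∷ l) (y ∷ g) (z ∷ r)) ⟩
        u ∷ v ∷ (x ∷ l) ++ (y ∷ g) ++ z ∷ r          ≡⟨ cong (λ q → u ∷ v ∷ (x ∷ l) ++ q) s≡ ⟨
        u ∷ v ∷ (x ∷ l) ++ y ∷ s                     ↭⟨ prep u (prep v (++↭ʳ++ (x ∷ l) (y ∷ s))) ⟩
        u ∷ v ∷ (l ʳ++ x ∷ y ∷ s)                    ≡⟨ cong (λ q → u ∷ v ∷ q) P≡ ⟨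
        u ∷ v ∷ P                                    ∎

    -- `W` hangs off `x` outside `P`, so it may replace either arm of `P` at `x`; maximality of `P`
    -- makes it no longer than the arm it replaces.
    pendant-bound : ∀ {l x r W} → P ≡ l ʳ++ x ∷ r → Path (_∉ P) W → Linked E (x ∷ W) →
      length W ≤ length l × length W ≤ length r
    pendant-bound {l} {x} {r} {W} P≡ W-path lk =
      ℕ.+-cancelʳ-≤ (suc (length r)) (length W) (length l) (fits r (proj₂ xs) (λ v∈ → subst (_ ∈_) (sym P≡) (∈-resp-↭ (++↭ʳ++ l (x ∷ r)) (∈-++⁺ʳ l v∈))) P-length) ,
      ℕ.+-cancelʳ-≤ (suc (length l)) (length W) (length r) (fits l (proj₁ xs) (λ v∈ → subst (_ ∈_) (sym P≡) (∈-resp-↭ (↭-sym (ʳ++-↭ l x r)) (∈-++⁺ˡ v∈))) (trans P-length swap))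
      where
      xs = arms l (subst (Path _) P≡ P-path)
      P-length : length P ≡ length l + suc (length r)
      P-length = trans (cong length P≡) (length-ʳ++ l)
      swap : length l + suc (length r) ≡ length r + suc (length l)
      swap = lemma (length l) (length r)
        where
        lemma : ∀ a b → a + suc b ≡ b + suc a
        lemma = solve-∀
      fits : ∀ m {k} → Path (λ _ → ⊤) (x ∷ m) → (∀ {v} → v ∈ x ∷ m → v ∈ P) → length P ≡ k →
        length W + suc (length m) ≤ k
      fits m xm ⊆P refl = subst (_≤ length P) (length-ʳ++ W)
        (P-longest _ (joinArms xW xm λ v∈W v∈ → All.lookup (within W-path) v∈W (⊆P v∈)))
        where
        xW : Path (λ _ → ⊤) (x ∷ W)
        xW = path lk (All.¬Any⇒All¬ W (λ x∈W → All.lookup (within W-path) x∈W (⊆P (here refl))) ∷ unique W-path) (All.universal (λ _ → tt) _)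

    module _ {A : List V} (A∉P : All (_∉ P) A) where

      Hit : Pred V 0ℓ
      Hit x = Any (E x) A

      hit? : Decidable Hit
      hit? x = Any.any? (E? x) A

      -- The label of a hit is one chosen neighbour in `A`, so two consecutive hits yield one
      -- ordered pair from `A`.
      labels : List V → List (V × V)
      labels = consecutive hit? (λ {x} → Any.lookup {P = E x})

      private
        ∉P : ∀ {v} → v ∈ A → v ∉ P
        ∉P = All.lookup A∉P

        label-edge : ∀ {x} (p : Hit x) → E (Any.lookup p) x
        label-edge p = E-sym (lookup-edge p)
          where
          lookup-edge : ∀ {x B} (p : Any (E x) B) → E x (Any.lookup p)
          lookup-edge (here e)  = e
          lookup-edge (there p) = lookup-edge p

        label-∈ : ∀ {x B} (p : Any (E x) B) → Any.lookup p ∈ B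
        label-∈ (here _)  = here refl
        label-∈ (there p) = there (label-∈ p)

      labels-straddle : ∀ r {v u} → (v , u) ∈ labels r → v ∈ A × u ∈ A × Straddle v u r
      labels-straddle (x ∷ y ∷ r) {v} {u} vu∈ with hit? x | hit? y | labels-straddle (y ∷ r) {v} {u}
      labels-straddle (x ∷ y ∷ r) (here refl) | yes p | yes q | _ =
        label-∈ p , label-∈ q , here (label-edge p) (label-edge q)
      labels-straddle (x ∷ y ∷ r) (there vu∈) | yes _ | yes _ | later =
        let v∈ , u∈ , st = later vu∈ in v∈ , u∈ , there st
      labels-straddle (x ∷ y ∷ r) vu∈ | yes _ | no _ | later =
        let v∈ , u∈ , st = later vu∈ in v∈ , u∈ , there st
      labels-straddle (x ∷ y ∷ r) vu∈ | no _ | _ | later =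
        let v∈ , u∈ , st = later vu∈ in v∈ , u∈ , there st

      straddle-≢ : ∀ l {r v u} → P ≡ l ʳ++ r → v ∉ P → Straddle v u r → v ≢ u
      straddle-≢ l P≡ v∉ (here vx uy) refl = ¬insert {l = l} P≡ v∉ vx uy
      straddle-≢ l P≡ v∉ (there {x} st)    = straddle-≢ (x ∷ l) P≡ v∉ st

      -- A recurrence of the pair at `x`, `y` would be a `Straddle` of `y ∷ r`, which `¬cross` rules
      -- out. Overlapping pairs are covered, since the recurrence may already start at `y`.
      labels-unique : ∀ l r → P ≡ l ʳ++ r → Unique (labels r)
      labels-unique l []          P≡ = []
      labels-unique l (x ∷ [])    P≡ = []
      labels-unique l (x ∷ y ∷ r) P≡ with hit? x | hit? y | labels-unique (x ∷ l) (y ∷ r) P≡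
      ... | yes p | yes q | later = All.tabulate distinct ∷ later
        where
        v∉ = ∉P (label-∈ p)
        u∉ = ∉P (label-∈ q)
        distinct : ∀ {vu} → vu ∈ labels (y ∷ r) → (Any.lookup p , Any.lookup q) ≢ vu
        distinct vu∈ refl = ¬cross {l = l} P≡ v∉ u∉
          (straddle-≢ l P≡ v∉ (here (label-edge p) (label-edge q)))
          (label-edge p) (label-edge q) (proj₂ (proj₂ (labels-straddle (y ∷ r) vu∈)))
      ... | yes _ | no _ | later = later
      ... | no _  | _    | later = later

      labels-bound : Unique A → length (labels P) + length A ≤ length A * length A
      labels-bound uq = offDiagonal-bound A uq (labels-unique [] P refl) λ vu∈ →
        let v∈ , u∈ , st = labels-straddle P vu∈ in v∈ , u∈ , straddle-≢ [] refl (∉P v∈) st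

  -- Depth-first search within a vertex predicate.

  module Search {R : Pred V 0ℓ} (R? : Decidable R) where

    -- The path from `a` has more than m/2 vertices, stated without division.
    StartsLong : ℕ → Pred V 0ℓ
    StartsLong m a = ∃ λ W → Path R (a ∷ W) × suc m ≤ 2 * suc (length W)

    -- `a` belongs to both arms, which together have |Z| + 1 vertices; the longer has at least half
    -- of them.
    longerArm : ∀ {Z a} → Path R Z → a ∈ Z →
      ∃ λ W → Path R (a ∷ W) × All (_∈ Z) (a ∷ W) × suc (length Z) ≤ 2 * suc (length W)
    longerArm {Z} {a} Z-path a∈Z with ∈⇒ʳ++ a∈Z
    -- Membership in `Z` is added to the vertex predicate so that `arms` passes it on to whichever
    -- arm is chosen.
    ... | l , r , refl with arms l (path-map {S = λ v → R v × v ∈ Z} id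
            (path (linked Z-path) (unique Z-path) (All.zip (within Z-path , All.tabulate id))))
    ...   | al , ar with ℕ.≤-total (length l) (length r)
    ...     | inj₁ l≤r = r , path-map proj₁ ar , All.map proj₂ (within ar) , (begin
      suc (length Z)                       ≡⟨ cong suc (length-ʳ++ l) ⟩
      suc (length l + suc (length r))      ≤⟨ s≤s (ℕ.+-monoˡ-≤ (suc (length r)) l≤r) ⟩
      suc (length r) + suc (length r)      ≡⟨ double (suc (length r)) ⟩
      2 * suc (length r)                   ∎)
      where
      open ℕ.≤-Reasoning
      double : ∀ a → a + a ≡ 2 * a
      double = solve-∀
    ...     | inj₂ r≤l = l , path-map proj₁ al , All.map proj₂ (within al) , (begin
      suc (length Z)                       ≡⟨ cong suc (length-ʳ++ l) ⟩
      suc (length l + suc (length r))      ≤⟨ s≤s (ℕ.+-monoʳ-≤ (length l) (s≤s r≤l)) ⟩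
      suc (length l) + suc (length l)      ≡⟨ double (suc (length l)) ⟩
      2 * suc (length l)                   ∎)
      where
      open ℕ.≤-Reasoning
      double : ∀ a → a + a ≡ 2 * a
      double = solve-∀

    -- `a ∷ Y` is followed only until it first meets `Z`, which `end` guarantees; then the longer
    -- arm of `Z` takes over. Vertices passed earlier are off `Z`, and the recorded inclusion of `W`
    -- shows each prepended vertex to be fresh.
    follow : ∀ {Z a} Y → Path R Z → Path R (a ∷ Y) → Maybe.All (_∈ Z) (last (a ∷ Y)) →
      ∃ λ W → Path R (a ∷ W) × All (λ w → w ∈ a ∷ Y ⊎ w ∈ Z) (a ∷ W) × suc (length Z) ≤ 2 * suc (length W)
    follow {Z} {a} Y Z-path Y-path end with a ∈? Z
    ... | yes a∈Z = let W , W-path , W⊆Z , long = longerArm Z-path a∈Z in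
      W , W-path , All.map inj₂ W⊆Z , long
    follow []      Z-path Y-path (just a∈Z) | no a∉Z = contradiction a∈Z a∉Z
    follow {Z} {a} (b ∷ Y) Z-path (path (ab ∷ lk) (a≢ ∷ uq) (ra ∷ wi)) end | no a∉Z
      with follow Y Z-path (path lk uq wi) end
    ... | W , W-path , W⊆ , long =
      b ∷ W , path-∷ ab a∉ ra W-path , inj₁ (here refl) ∷ All.map [ inj₁ ∘ there , inj₂ ]′ W⊆ ,
      ℕ.≤-trans long (ℕ.*-monoʳ-≤ 2 (ℕ.n≤1+n (suc (length W))))
      where
      a∉ : a ∉ b ∷ W
      a∉ a∈ = [ All.All¬⇒¬Any a≢ , a∉Z ]′ (All.lookup W⊆ a∈)

    -- A: the finished vertices; Q: the stack, top first; Z: a longest path outside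
    -- the part of A that was finished when the stack was last empty.  The bottom of
    -- the stack lies on Z, so a popped vertex can run down the stack to Z and
    -- continue along the longer half of Z; this gives A-long.
    record State (A Q Z : List V) : Set where
      field
        A-unique : Unique A
        A-within : All R A
        A-long   : All (StartsLong (length Z)) A
        closed   : ∀ {a w} → a ∈ A → R w → E a w → w ∈ A ⊎ w ∈ Q
        Q-path   : Path (λ v → R v × v ∉ A) Q
        Z-path   : Path R Z
        Z-max    : ∀ ys → Path (λ v → R v × v ∉ A) ys → length ys ≤ length Z
        rooted   : Maybe.All (_∈ Z) (last Q)

      Q-bound : length Q ≤ length Z
      Q-bound = Z-max Q Q-path

      size-bound : length A + length Q ≤ N
      size-bound = subst (_≤ N) (length-++ A) (length≤N (Unique.++⁺ A-unique (unique Q-path)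
        λ (v∈A , v∈Q) → proj₂ (All.lookup (within Q-path) v∈Q) v∈A))

    open State

    unused? : ∀ A → Decidable (λ v → R v × v ∉ A)
    unused? A v = R? v ×-dec ¬? (v ∈? A)

    restart : ∀ {A Z} → State A [] Z → (∃ λ w → R w × w ∉ A) → ∃₂ λ z Z′ → State A (z ∷ []) Z′
    restart {A} {Z} st (w , rw , w∉) with longestPath (unused? A)
    -- `w` alone is a path, so a longest path is nonempty.
    ... | []     , _       , Z′-max = contradiction (Z′-max (w ∷ []) (path [-] ([] ∷ []) ((rw , w∉) ∷ []))) λ ()
    ... | z ∷ Z′ , Z′-path , Z′-max = z , z ∷ Z′ , record
      { A-unique = A-unique st
      ; A-within = A-within st
      -- The new path avoids `A`, so by `Z-max` it is no longer than `Z`, and the old bounds survive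
      -- with the smaller length.
      ; A-long   = All.map (λ (W , W-path , long) → W , W-path , ℕ.≤-trans (s≤s (Z-max st _ Z′-path)) long) (A-long st)
      ; closed   = λ a∈ rw e → [ inj₁ , (λ ()) ]′ (closed st a∈ rw e)
      ; Q-path   = path [-] ([] ∷ []) (All.head (within Z′-path) ∷ [])
      ; Z-path   = path-map proj₁ Z′-path
      ; Z-max    = Z′-max
      ; rooted   = just (here refl)
      }

    push : ∀ {A Q Z q w} → State A (q ∷ Q) Z → R w → w ∉ A → w ∉ q ∷ Q → E w q → State A (w ∷ q ∷ Q) Z
    push st rw w∉A w∉Q e = record
      { A-unique = A-unique st
      ; A-within = A-within st
      ; A-long   = A-long st
      ; closed   = λ a∈ rw e → [ inj₁ , inj₂ ∘ there ]′ (closed st a∈ rw e)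
      ; Q-path   = path-∷ e w∉Q (rw , w∉A) (Q-path st)
      ; Z-path   = Z-path st
      ; Z-max    = Z-max st
      ; rooted   = rooted st
      }

    pop : ∀ {A Q Z q} → State A (q ∷ Q) Z → (∀ {w} → R w → E q w → w ∈ A ⊎ w ∈ q ∷ Q) → State (q ∷ A) Q Z
    pop {A} {Q} {Z} {q} st stuck = record
      { A-unique = All.¬Any⇒All¬ A (proj₂ (All.head (within (Q-path st)))) ∷ A-unique st
      ; A-within = proj₁ (All.head (within (Q-path st))) ∷ A-within st
      ; A-long   = (let W , W-path , _ , long = follow Q (Z-path st) (path-map proj₁ (Q-path st)) (rooted st) in
                    W , W-path , long) ∷ A-long st
      ; closed   = λ { (here refl) rw e → move (stuck rw e) ; (there a∈) rw e → move (closed st a∈ rw e) }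
      ; Q-path   = tail-path (Q-path st)
      ; Z-path   = Z-path st
      -- Excluding `q` as well only leaves fewer paths to compare with `Z`.
      ; Z-max    = λ ys p → Z-max st ys (path-map (λ (r , v∉) → r , v∉ ∘ there) p)
      ; rooted   = last-tail Q (rooted st)
      }
      where
      move : ∀ {w} → w ∈ A ⊎ w ∈ q ∷ Q → w ∈ q ∷ A ⊎ w ∈ Q
      move (inj₁ w∈A)         = inj₁ (there w∈A)
      move (inj₂ (here refl)) = inj₁ (here refl)
      move (inj₂ (there w∈Q)) = inj₂ w∈Q
      tail-path : Path (λ v → R v × v ∉ A) (q ∷ Q) → Path (λ v → R v × v ∉ q ∷ A) Q
      tail-path (path lk (q≢ ∷ uq) (_ ∷ wi)) = path (Linked.tail lk) uq
        (All.zipWith (λ { (q≢v , (rv , v∉A)) → rv , λ { (here refl) → q≢v refl ; (there v∈A) → v∉A v∈A } }) (q≢ , wi))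
      last-tail : ∀ Q → Maybe.All (_∈ Z) (last (q ∷ Q)) → Maybe.All (_∈ Z) (last Q)
      last-tail []      _   = nothing
      last-tail (_ ∷ _) end = end

    module _ (s : ℕ) (available : ∀ A → length A <ℕ s → ∃ λ w → R w × w ∉ A) where

      -- Each move raises 2|A| + |Q| by exactly one: `restart` and `push` add a vertex to the stack,
      -- `pop` moves one from the stack to `A`. As `A` and `Q` are disjoint, the measure is at most
      -- 2N, so the fuel suffices. Only `pop` enlarges `A`, by one vertex, so size `s` is met
      -- exactly.
      run : ∀ fuel {A Q Z} → 2 * N <ℕ fuel + (2 * length A + length Q) → length A ≤ s → State A Q Z →
        ∃ λ A → ∃₂ λ Q Z → length A ≡ s × State A Q Z
      run zero {A} {Q} enough _ st = contradiction enough (ℕ.≤⇒≯ (begin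
        2 * length A + length Q         ≤⟨ ℕ.+-monoʳ-≤ (2 * length A) (ℕ.m≤n*m (length Q) 2) ⟩
        2 * length A + 2 * length Q     ≡⟨ ℕ.*-distribˡ-+ 2 (length A) (length Q) ⟨
        2 * (length A + length Q)       ≤⟨ ℕ.*-monoʳ-≤ 2 (size-bound st) ⟩
        2 * N                           ∎))
        where open ℕ.≤-Reasoning
      run (suc fuel) {A} {Q} enough A≤s st with length A ℕ.≟ s
      ... | yes |A|≡s = A , Q , _ , |A|≡s , st
      run (suc fuel) {A} {[]} enough A≤s st | no |A|≢s
        with restart st (available A (ℕ.≤∧≢⇒< A≤s |A|≢s))
      ... | z , Z , st′ = run fuel (subst (2 * N <ℕ_) (step fuel (length A)) enough) A≤s st′
        where
        step : ∀ f a → suc f + (2 * a + 0) ≡ f + (2 * a + 1)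
        step = solve-∀
      run (suc fuel) {A} {q ∷ Q} enough A≤s st | no |A|≢s
        with Fin.any? (λ w → E? w q ×-dec unused? A w ×-dec ¬? (w ∈? q ∷ Q))
      ... | yes (w , e , (rw , w∉A) , w∉Q) =
        run fuel (subst (2 * N <ℕ_) (step fuel (length A) (length Q)) enough) A≤s (push st rw w∉A w∉Q e)
        where
        step : ∀ f a q → suc f + (2 * a + suc q) ≡ f + (2 * a + suc (suc q))
        step = solve-∀
      ... | no ¬w =
        run fuel (subst (2 * N <ℕ_) (step fuel (length A) (length Q)) enough) (ℕ.≤∧≢⇒< A≤s |A|≢s) (pop st stuck)
        where
        step : ∀ f a q → suc f + (2 * a + suc q) ≡ f + (2 * suc a + q)
        step = solve-∀
        stuck : ∀ {w} → R w → E q w → w ∈ A ⊎ w ∈ q ∷ Q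
        stuck {w} rw e with w ∈? A | w ∈? q ∷ Q
        ... | yes w∈A | _       = inj₁ w∈A
        ... | no _    | yes w∈Q = inj₂ w∈Q
        ... | no w∉A  | no w∉Q  = contradiction (w , E-sym e , (rw , w∉A) , w∉Q) ¬w

      search : ∃ λ A → ∃₂ λ Q Z → length A ≡ s × State A Q Z
      search with longestPath R?
      ... | Z , Z-path , Z-max = run (suc (2 * N)) (ℕ.m≤m+n _ _) z≤n (record
        { A-unique = []
        ; A-within = []
        ; A-long   = []
        ; closed   = λ ()
        ; Q-path   = path [] [] []
        ; Z-path   = Z-path
        ; Z-max    = λ ys p → Z-max ys (path-map proj₁ p)
        ; rooted   = nothing
        })

  -- Counting around a longest path.

  module _ {s t : ℕ} (N-large : s * s + (t + t) ≤ suc N)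
    {P : List V} (P-path : Path (λ _ → ⊤) P) (P-longest : Longest (λ _ → ⊤) P) (P-short : length P + s ≤ N) where

    open Extremal P-path P-longest

    private
      outside? : Decidable (_∉ P)
      outside? v = ¬? (v ∈? P)

      module S = Search outside?

      available : ∀ A → length A <ℕ s → ∃ λ w → w ∉ P × w ∉ A
      available A A<s with missing (P ++ A) (subst (_<ℕ N) (sym (length-++ P)) (ℕ.<-≤-trans (ℕ.+-monoʳ-< (length P) A<s) P-short))
      ... | w , w∉ = w , w∉ ∘ ∈-++⁺ˡ , w∉ ∘ ∈-++⁺ʳ P

      module Counting {A Q Z : List V} (st : S.State A Q Z) where

        open S.State st

        X T : List V
        X = filter (hit? A-within) P
        free? : Decidable (λ w → w ∉ A × ¬ Hit A-within w)
        free? w = ¬? (w ∈? A) ×-dec ¬? (hit? A-within w)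
        T = filter free? (allFin N)

        k q x pairs τ h : ℕ
        k = length P
        q = length Q
        x = length X
        pairs = length (labels A-within P)
        τ = length T
        -- The least integer exceeding q/2. Since q ≤ |Z|, the long path from each vertex of `A` has
        -- at least this many vertices.
        h = suc ⌊ q /2⌋

        h-minimal : ∀ {m} → suc q ≤ 2 * m → h ≤ m
        h-minimal {m} q<2m = begin
          ⌊ suc (suc q) /2⌋     ≤⟨ ℕ.⌊n/2⌋-mono (s≤s q<2m) ⟩
          ⌈ 2 * m /2⌉           ≡⟨ cong (λ n → ⌈ m + n /2⌉) (ℕ.+-identityʳ m) ⟩
          ⌈ m + m /2⌉           ≡⟨ ℕ.n≡⌈n+n/2⌉ m ⟨
          m                     ∎
          where open ℕ.≤-Reasoning

        q<2h : suc q ≤ 2 * h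
        q<2h = begin
          suc q                                  ≡⟨ cong suc (ℕ.⌊n/2⌋+⌈n/2⌉≡n q) ⟨
          suc (⌊ q /2⌋ + ⌈ q /2⌉)                ≤⟨ s≤s (ℕ.+-monoʳ-≤ ⌊ q /2⌋ (ℕ.⌊n/2⌋-mono (ℕ.n≤1+n (suc q)))) ⟩
          suc (⌊ q /2⌋ + suc ⌊ q /2⌋)            ≡⟨ double ⌊ q /2⌋ ⟩
          2 * h                                  ∎
          where
          open ℕ.≤-Reasoning
          double : ∀ a → suc (a + suc a) ≡ 2 * suc a
          double = solve-∀

        -- `x` has a neighbour in `A` whose long path avoids `P` and can be attached at `x`, so
        -- `pendant-bound` applies.
        inner : ∀ l x r → P ≡ l ʳ++ x ∷ r → Hit A-within x → h ≤ length l × h ≤ length r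
        inner l x r P≡ hit with All.lookupAny A-long hit
        ... | (W , W-path , long) , xa =
          let W≤l , W≤r = pendant-bound {l} {x} {r} P≡ W-path (xa ∷ linked W-path)
              h≤W = h-minimal (ℕ.≤-trans (s≤s Q-bound) long)
          in ℕ.≤-trans h≤W W≤l , ℕ.≤-trans h≤W W≤r

        X-bound : 2 * x + q ≤ k + pairs
        X-bound with hits-bound (hit? A-within) (λ {v} → Any.lookup {P = E v}) P h inner
        -- Without hits `inner` says nothing about `q`; but the stack is itself a path, so |Q| ≤ |P|
        -- closes the case.
        ... | inj₁ none = begin
          2 * x + q     ≡⟨ cong (λ n → 2 * n + q) none ⟩
          q             ≤⟨ P-longest Q (path-map (λ _ → tt) Q-path) ⟩
          k             ≤⟨ ℕ.m≤m+n k pairs ⟩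
          k + pairs     ∎
          where open ℕ.≤-Reasoning
        -- Replacing 2h by q + 1 cancels the extra `1` of `hits-bound`.
        ... | inj₂ some = ℕ.+-cancelʳ-≤ 1 (2 * x + q) (k + pairs) (begin
          2 * x + q + 1         ≡⟨ reassoc (2 * x) q ⟩
          2 * x + suc q         ≤⟨ ℕ.+-monoʳ-≤ (2 * x) q<2h ⟩
          2 * x + 2 * h         ≤⟨ some ⟩
          k + pairs + 1         ∎)
          where
          open ℕ.≤-Reasoning
          reassoc : ∀ a b → a + b + 1 ≡ a + suc b
          reassoc = solve-∀

        packing : k + (length A + q) ≤ N
        packing = subst (_≤ N) (trans (length-++ P) (cong (k +_) (length-++ A)))
          (length≤N (Unique.++⁺ (unique P-path)
            (Unique.++⁺ A-unique (unique Q-path) λ (v∈A , v∈Q) → proj₂ (All.lookup (within Q-path) v∈Q) v∈A)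
            λ (v∈P , v∈) → [ (λ v∈A → All.lookup A-within v∈A v∈P) , (λ v∈Q → proj₁ (All.lookup (within Q-path) v∈Q) v∈P) ]′ (∈-++⁻ A v∈)))

        -- A neighbour of `A` off `P` lies in `A` or `Q` by `closed`; one on `P` lies in `X`; every
        -- other vertex is in `A` or `T`.
        covering : N ≤ (length A + q) + (x + τ)
        covering = subst (N ≤_) (trans (length-++ (A ++ Q)) (cong₂ _+_ (length-++ A) (length-++ X)))
          (cover⇒N≤length {xs = (A ++ Q) ++ X ++ T} cover)
          where
          cover : ∀ v → v ∈ (A ++ Q) ++ X ++ T
          cover v with v ∈? A | hit? A-within v | v ∈? P
          ... | yes v∈A | _       | _       = ∈-++⁺ˡ (∈-++⁺ˡ v∈A)
          ... | no v∉A  | no ¬hit | _       = ∈-++⁺ʳ (A ++ Q) (∈-++⁺ʳ X (∈-filter⁺ free? (∈-allFin v) (v∉A , ¬hit)))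
          ... | no _    | yes hit | yes v∈P = ∈-++⁺ʳ (A ++ Q) (∈-++⁺ˡ (∈-filter⁺ (hit? A-within) v∈P hit))
          ... | no _    | yes hit | no v∉P  with All.lookupAny (All.tabulate (λ a∈A → closed a∈A v∉P)) hit
          ...   | move , va = ∈-++⁺ˡ ([ ∈-++⁺ˡ , ∈-++⁺ʳ A ]′ (move (E-sym va)))

        -- Doubling `covering` makes room for `X-bound`; after `labels-bound` and `packing` it reads
        -- N ≤ s² + 2τ. With s² + 2t ≤ N + 1 this gives 2t ≤ 2τ + 1, and parity removes the last
        -- one.
        T-large : length A ≡ s → t ≤ τ
        T-large refl = ℕ.≮⇒≥ λ τ<t → ℕ.<⇒≱ (begin-strict
          s * s + (τ + τ) + N                                   <⟨ ℕ.+-monoˡ-< N (ℕ.+-monoʳ-< (s * s) (ℕ.n<1+n (τ + τ))) ⟩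
          s * s + suc (τ + τ) + N                               ≤⟨ ℕ.+-monoˡ-≤ N (ℕ.≤-pred (ℕ.≤-trans (double τ<t) N-large)) ⟩
          N + N                                                 ∎)
          (begin
          N + N                                                 ≤⟨ ℕ.+-mono-≤ covering covering ⟩
          (s + q) + (x + τ) + ((s + q) + (x + τ))               ≡⟨ reassoc₁ s q x τ ⟩
          (2 * x + q) + (s + s + q + (τ + τ))                   ≤⟨ ℕ.+-monoˡ-≤ (s + s + q + (τ + τ)) X-bound ⟩
          (k + pairs) + (s + s + q + (τ + τ))                   ≡⟨ reassoc₂ k pairs s q τ ⟩
          (pairs + s) + (τ + τ) + (k + (s + q))                 ≤⟨ ℕ.+-mono-≤ (ℕ.+-monoˡ-≤ (τ + τ) (labels-bound A-within A-unique)) packing ⟩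
          s * s + (τ + τ) + N                                   ∎)
          where
          open ℕ.≤-Reasoning
          double : τ <ℕ t → suc (s * s + suc (τ + τ)) ≤ s * s + (t + t)
          double τ<t = subst (_≤ s * s + (t + t)) (reassoc (s * s) τ) (ℕ.+-monoʳ-≤ (s * s) (ℕ.+-mono-≤ τ<t τ<t))
            where
            reassoc : ∀ a b → a + (suc b + suc b) ≡ suc (a + suc (b + b))
            reassoc = solve-∀
          reassoc₁ : ∀ s q x τ → (s + q) + (x + τ) + ((s + q) + (x + τ)) ≡ (2 * x + q) + (s + s + q + (τ + τ))
          reassoc₁ = solve-∀
          reassoc₂ : ∀ k p s q τ → (k + p) + (s + s + q + (τ + τ)) ≡ (p + s) + (τ + τ) + (k + (s + q))
          reassoc₂ = solve-∀

    -- With `E` as red adjacency, such a hole is a blue complete bipartite graph.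
    bipartiteHole : ∃₂ λ A T → length A ≡ s × t ≤ length T × Unique A × Unique T ×
      (∀ {a w} → a ∈ A → w ∈ T → a ≢ w × ¬ E a w)
    bipartiteHole with S.search s available
    ... | A , Q , Z , |A|≡s , st =
      A , T , |A|≡s , T-large |A|≡s , S.State.A-unique st , Unique.filter⁺ free? (Unique.allFin⁺ N) , apart
      where
      open Counting st
      apart : ∀ {a w} → a ∈ A → w ∈ T → a ≢ w × ¬ E a w
      apart a∈A w∈T with proj₂ (∈-filter⁻ free? {xs = allFin N} w∈T)
      ... | w∉A , ¬hit = (λ { refl → w∉A a∈A }) , λ aw → ¬hit (Any.map (λ { refl → E-sym aw }) a∈A)

-- From the rational hypotheses to an inequality of natural numbers.

toℚᵘ-ℕ→ℚ : ∀ m → toℚᵘ (ℕ→ℚ m) ℚᵘ.≃ ℚᵘ.mkℚᵘ (pos m) 0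
toℚᵘ-ℕ→ℚ m = ℚ.toℚᵘ-fromℚᵘ (ℚᵘ.mkℚᵘ (pos m) 0)

-- `_/_` reduces by a gcd and does not compute at a variable, so the identity is checked on
-- unnormalised fractions with denominator one.
ℕ→ℚ-homo-+ : ∀ m n → ℕ→ℚ (m + n) ≡ ℕ→ℚ m +ℚ ℕ→ℚ n
ℕ→ℚ-homo-+ m n = ℚ.toℚᵘ-injective (begin
  toℚᵘ (ℕ→ℚ (m + n))                       ≈⟨ toℚᵘ-ℕ→ℚ (m + n) ⟩
  ℚᵘ.mkℚᵘ (pos (m + n)) 0                    ≡⟨ cong (λ z → ℚᵘ.mkℚᵘ z 0) (sym (cong₂ ℤ._+_ (ℤ.*-identityʳ (pos m)) (ℤ.*-identityʳ (pos n)))) ⟩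
  ℚᵘ.mkℚᵘ (pos m) 0 ℚᵘ.+ ℚᵘ.mkℚᵘ (pos n) 0     ≈⟨ ℚᵘ.+-cong (toℚᵘ-ℕ→ℚ m) (toℚᵘ-ℕ→ℚ n) ⟨
  toℚᵘ (ℕ→ℚ m) ℚᵘ.+ toℚᵘ (ℕ→ℚ n)           ≈⟨ ℚ.toℚᵘ-homo-+ (ℕ→ℚ m) (ℕ→ℚ n) ⟨
  toℚᵘ (ℕ→ℚ m +ℚ ℕ→ℚ n)                    ∎)
  where open import Relation.Binary.Reasoning.Setoid ℚᵘ.≃-setoid

ℕ→ℚ-cancel-≤ : ∀ {m n} → ℕ→ℚ m ≤ℚ ℕ→ℚ n → m ≤ n
ℕ→ℚ-cancel-≤ {m} {n} m≤n
  with ℚᵘ.*≤* m*1≤n*1 ← ℚᵘ.≤-respʳ-≃ (toℚᵘ-ℕ→ℚ n) (ℚᵘ.≤-respˡ-≃ (toℚᵘ-ℕ→ℚ m) (ℚ.toℚᵘ-mono-≤ m≤n))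
  = ℤ.drop‿+≤+ (subst₂ ℤ._≤_ (ℤ.*-identityʳ (pos m)) (ℤ.*-identityʳ (pos n)) m*1≤n*1)

-- The left sides of the two hypotheses sum to s² + 2t + εt - s and the right sides to εt + n;
-- adding s - εt to both eliminates ε.
order-bound : ∀ ε s t n →
  (ℕ→ℚ (s * s) -ℚ ((ℕ→ℚ 3 +ℚ ε) *ℚ ℕ→ℚ s)) ≤ℚ (ε *ℚ ℕ→ℚ t) →
  ((ℕ→ℚ 2 +ℚ ε) *ℚ ℕ→ℚ (s + t)) ≤ℚ ℕ→ℚ n →
  s * s + (t + t) ≤ n + s
order-bound ε s t n h₁ h₂ = ℕ→ℚ-cancel-≤ (begin
  ℕ→ℚ (s * s + (t + t))
    ≡⟨ trans (ℕ→ℚ-homo-+ (s * s) (t + t)) (cong (ℕ→ℚ (s * s) +ℚ_) (ℕ→ℚ-homo-+ t t)) ⟩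
  ℕ→ℚ (s * s) +ℚ (T +ℚ T)
    ≡⟨ solve 4 (λ q e s t → q :+ (t :+ t) := (q :- (con (ℕ→ℚ 3) :+ e) :* s) :+ ((con (ℕ→ℚ 2) :+ e) :* (s :+ t) :+ (s :- e :* t))) refl (ℕ→ℚ (s * s)) ε S T ⟩
  (ℕ→ℚ (s * s) -ℚ ((ℕ→ℚ 3 +ℚ ε) *ℚ S)) +ℚ ((ℕ→ℚ 2 +ℚ ε) *ℚ (S +ℚ T) +ℚ (S -ℚ ε *ℚ T))
    ≤⟨ ℚ.+-mono-≤ h₁ (ℚ.+-monoˡ-≤ (S -ℚ ε *ℚ T) (subst (λ z → ((ℕ→ℚ 2 +ℚ ε) *ℚ z) ≤ℚ ℕ→ℚ n) (ℕ→ℚ-homo-+ s t) h₂)) ⟩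
  (ε *ℚ T) +ℚ (ℕ→ℚ n +ℚ (S -ℚ ε *ℚ T))
    ≡⟨ solve 3 (λ a n s → a :+ (n :+ (s :- a)) := n :+ s) refl (ε *ℚ T) (ℕ→ℚ n) S ⟩
  ℕ→ℚ n +ℚ S
    ≡⟨ ℕ→ℚ-homo-+ n s ⟨
  ℕ→ℚ (n + s) ∎)
  where
  open ℚ.≤-Reasoning
  open +-*-Solver
  S = ℕ→ℚ s
  T = ℕ→ℚ t

-- Red paths and blue bipartite graphs in a colouring.

red? : ∀ k → Dec (k ≡ red)
red? red  = yes refl
red? blue = no λ ()

≢red⇒blue : ∀ {k} → k ≢ red → k ≡ blue
≢red⇒blue {red}  k≢red = contradiction refl k≢red
≢red⇒blue {blue} _     = refl

module _ {N : ℕ} (c : Colouring N) where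

  pathCopy : ∀ {n k xs} → Linked (λ u v → col c u v ≡ k) xs → Unique xs → n ≤ length xs → PathCopy c k n
  pathCopy {xs = xs} lk uq n≤ = record
    { vtx  = λ i → lookup xs (inject≤ i n≤)
    ; inj  = λ eq → Fin.inject≤-injective n≤ n≤ _ _ (lookup-injective uq eq)
    ; edge = λ i j j≡ → lookup-linked lk (inject≤ i n≤) (inject≤ j n≤)
        (trans (Fin.toℕ-inject≤ j n≤) (trans j≡ (cong suc (sym (Fin.toℕ-inject≤ i n≤)))))
    }

  bipCopy : ∀ {t k A T} → Unique A → Unique T → t ≤ length T →
    (∀ {a w} → a ∈ A → w ∈ T → a ≢ w × col c a w ≡ k) → BipCopy c k (length A) t
  bipCopy {A = A} {T} uqᴬ uqᵀ t≤ joined = record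
    { left      = lookup A
    ; right     = λ j → lookup T (inject≤ j t≤)
    ; left-inj  = lookup-injective uqᴬ
    ; right-inj = λ eq → Fin.inject≤-injective t≤ t≤ _ _ (lookup-injective uqᵀ eq)
    ; disjoint  = λ i j → proj₁ (joined (∈-lookup i) (∈-lookup (inject≤ j t≤)))
    ; edge      = λ i j → proj₂ (joined (∈-lookup i) (∈-lookup (inject≤ j t≤)))
    }

theorem10 : (ε : ℚ) → 0ℚ < ε → ε ≤ℚ 1ℚ →
    (s t : ℕ) → 1 ≤ s → s ≤ t →
    (ℕ→ℚ (s * s) -ℚ ((ℕ→ℚ 3 +ℚ ε) *ℚ ℕ→ℚ s)) ≤ℚ (ε *ℚ ℕ→ℚ t) →
    (n N : ℕ) → ((ℕ→ℚ 2 +ℚ ε) *ℚ ℕ→ℚ (s + t)) ≤ℚ ℕ→ℚ n →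
    (n ∸ 1) + s ≤ N →
    Arrows N n s t
theorem10 ε _ _ s t _ _ ε-s-t n N ε-n n-N c = arrows (longestPath (λ _ → yes tt))
  where
  open Paths (λ u v → red? (col c u v)) (λ {u} {v} e → trans (symm c v u) e)

  N-large : s * s + (t + t) ≤ suc N
  N-large = begin
    s * s + (t + t)     ≤⟨ order-bound ε s t n ε-s-t ε-n ⟩
    -- n ≤ 1 + (n ∸ 1) also covers n = 0, where the subtraction is truncated.
    n + s               ≤⟨ ℕ.+-monoˡ-≤ s (ℕ.m≤n+m∸n n 1) ⟩
    suc (n ∸ 1 + s)     ≤⟨ s≤s n-N ⟩
    suc N               ∎
    where open ℕ.≤-Reasoning

  arrows : (∃ λ P → Path (λ _ → ⊤) P × Longest (λ _ → ⊤) P) → PathCopy c red n ⊎ BipCopy c blue s t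
  arrows (P , P-path , P-longest) with n ≤? length P
  ... | yes n≤P = inj₁ (pathCopy c (Path.linked P-path) (Path.unique P-path) n≤P)
  ... | no  n≰P with bipartiteHole N-large P-path P-longest
                       (ℕ.≤-trans (ℕ.+-monoˡ-≤ s (ℕ.∸-monoˡ-≤ 1 (ℕ.≰⇒> n≰P))) n-N)
  ...   | A , T , |A|≡s , t≤T , uqᴬ , uqᵀ , apart =
    inj₂ (subst (λ m → BipCopy c blue m t) |A|≡s (bipCopy c uqᴬ uqᵀ t≤T λ a∈ w∈ →
      let a≢w , ¬red = apart a∈ w∈ in a≢w , ≢red⇒blue ¬red))
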